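{- Let $X$ be a finite set and $f:2^X\to\mathbb{R}_{\ge0}$ a normalized monotone submodular function which possesses supermodularity of conditioning. Then for every $S\subseteq X$ and every $x\in X\setminus S$, \[ f(x\mid S)\ \ge\ f(x)-\sum_{y\in S}\big(f(x)-f(x\mid y)\big). \]
   Context: $f(x\mid A):=f(A\cup\{x\})-f(A)$, and more generally for sets $T,A$, $f(T\mid A):=f(A\cup T)-f(A)$; $f(T\mid A,C):=f(T\mid A\cup C)$; $f(x):=f(\{x\})$, $f(x\mid y):=f(x\mid\{y\})$. Supermodularity of conditioning: for all $S\subseteq X$, $A\subseteq B\subseteq X$ and $C\subseteq X\setminus B$, $f(S\mid A)-f(S\mid A\cup C)\ge f(S\mid B)-f(S\mid B\cup C)$. -}

module Defs where

open import Data.Bool.Base using (true; false)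
open import Data.Fin.Base using (Fin; zero; suc)
open import Data.Fin.Subset using (Subset; ⊥; ⁅_⁆; ∁; _∪_; _∩_; _⊆_)
open import Data.Nat.Base as ℕ using (ℕ; _⊔_)
import Data.Nat.Properties as ℕ
open import Data.Product.Base using (∃-syntax; _,_)
open import Data.Rational.Base as ℚ using (ℚ; 0ℚ; ½; ∣_∣)
import Data.Rational.Properties as ℚ
open import Data.Rational.Solver using (module +-*-Solver)
open import Data.Vec.Base using ([]; _∷_)
open import Relation.Binary.PropositionalEquality using (_≡_; refl; sym; trans; cong; subst)

------------------------------------------------------------------------
-- Real numbers: Cauchy sequences of rationals. Equality of reals is the
-- relation _≃_ below (the sequence differences tend to 0), not _≡_.

IsCauchy : (ℕ → ℚ) → Set
IsCauchy s = ∀ ε → 0ℚ ℚ.< ε →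
  ∃[ N ] (∀ m n → N ℕ.≤ m → N ℕ.≤ n → ∣ s m ℚ.- s n ∣ ℚ.≤ ε)

record ℝ : Set where
  constructor mkℝ
  field
    seq    : ℕ → ℚ
    cauchy : IsCauchy seq

open ℝ public

infix  4 _≃_ _≤_ _≥_
infixl 6 _+_ _-_
infix  8 -_

_≃_ : ℝ → ℝ → Set
x ≃ y = ∀ ε → 0ℚ ℚ.< ε →
  ∃[ N ] (∀ n → N ℕ.≤ n → ∣ seq x n ℚ.- seq y n ∣ ℚ.≤ ε)

-- The slack ε is needed: a termwise (or eventually termwise) comparison
-- of the sequences would not respect _≃_.
_≤_ : ℝ → ℝ → Set
x ≤ y = ∀ ε → 0ℚ ℚ.< ε →
  ∃[ N ] (∀ n → N ℕ.≤ n → seq x n ℚ.≤ seq y n ℚ.+ ε)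

_≥_ : ℝ → ℝ → Set
x ≥ y = y ≤ x

0ℝ : ℝ
0ℝ = mkℝ (λ _ → 0ℚ) λ ε 0<ε → 0 , λ _ _ _ _ → ℚ.<⇒≤ 0<ε

private
  half-pos : ∀ ε → 0ℚ ℚ.< ε → 0ℚ ℚ.< ½ ℚ.* ε
  half-pos ε 0<ε = subst (ℚ._< ½ ℚ.* ε) (ℚ.*-zeroʳ ½) (ℚ.*-monoʳ-<-pos ½ 0<ε)

  half+half : ∀ ε → ½ ℚ.* ε ℚ.+ ½ ℚ.* ε ≡ ε
  half+half ε = trans (sym (ℚ.*-distribʳ-+ ε ½ ½)) (ℚ.*-identityˡ ε)

  +-interchange-minus : ∀ a b c d →
    (a ℚ.+ b) ℚ.- (c ℚ.+ d) ≡ (a ℚ.- c) ℚ.+ (b ℚ.- d)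
  +-interchange-minus = solve 4
    (λ a b c d → (a :+ b) :- (c :+ d) := (a :- c) :+ (b :- d)) refl
    where open +-*-Solver

_+_ : ℝ → ℝ → ℝ
mkℝ s s-cauchy + mkℝ t t-cauchy = mkℝ (λ n → s n ℚ.+ t n) λ ε 0<ε →
  let M , s-close = s-cauchy (½ ℚ.* ε) (half-pos ε 0<ε)
      N , t-close = t-cauchy (½ ℚ.* ε) (half-pos ε 0<ε)
  in M ⊔ N , λ m n le le′ → begin
    ∣ (s m ℚ.+ t m) ℚ.- (s n ℚ.+ t n) ∣    ≡⟨ cong ∣_∣ (+-interchange-minus (s m) (t m) (s n) (t n)) ⟩
    ∣ (s m ℚ.- s n) ℚ.+ (t m ℚ.- t n) ∣    ≤⟨ ℚ.∣p+q∣≤∣p∣+∣q∣ (s m ℚ.- s n) (t m ℚ.- t n) ⟩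
    ∣ s m ℚ.- s n ∣ ℚ.+ ∣ t m ℚ.- t n ∣    ≤⟨ ℚ.+-mono-≤
                                                (s-close m n (ℕ.m⊔n≤o⇒m≤o M N le) (ℕ.m⊔n≤o⇒m≤o M N le′))
                                                (t-close m n (ℕ.m⊔n≤o⇒n≤o M N le) (ℕ.m⊔n≤o⇒n≤o M N le′)) ⟩
    ½ ℚ.* ε ℚ.+ ½ ℚ.* ε                    ≡⟨ half+half ε ⟩
    ε                                      ∎
  where open ℚ.≤-Reasoning

-_ : ℝ → ℝ
- mkℝ s s-cauchy = mkℝ (λ n → ℚ.- s n) λ ε 0<ε →
  let N , s-close = s-cauchy ε 0<ε
  in N , λ m n N≤m N≤n → begin
    ∣ (ℚ.- s m) ℚ.- (ℚ.- s n) ∣    ≡⟨ cong ∣_∣ (sym (ℚ.neg-distrib-+ (s m) (ℚ.- s n))) ⟩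
    ∣ ℚ.- (s m ℚ.- s n) ∣          ≡⟨ ℚ.∣-p∣≡∣p∣ (s m ℚ.- s n) ⟩
    ∣ s m ℚ.- s n ∣                ≤⟨ s-close m n N≤m N≤n ⟩
    ε                              ∎
  where open ℚ.≤-Reasoning

_-_ : ℝ → ℝ → ℝ
x - y = x + (- y)

∑ : ∀ {n} → Subset n → (Fin n → ℝ) → ℝ
∑ []          g = 0ℝ
∑ (true  ∷ S) g = g zero + ∑ S (λ i → g (suc i))
∑ (false ∷ S) g = ∑ S (λ i → g (suc i))

------------------------------------------------------------------------
-- Set functions on the finite ground set X = Fin n

module _ {n : ℕ} (f : Subset n → ℝ) where

  -- f(T ∣ A)
  marginal : Subset n → Subset n → ℝ
  marginal T A = f (A ∪ T) - f A

  NonNegative : Set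
  NonNegative = ∀ A → 0ℝ ≤ f A

  Normalized : Set
  Normalized = f ⊥ ≃ 0ℝ

  Monotone : Set
  Monotone = ∀ A B → A ⊆ B → f A ≤ f B

  Submodular : Set
  Submodular = ∀ A B → f A + f B ≥ f (A ∪ B) + f (A ∩ B)

  -- C ⊆ X ∖ B is C ⊆ ∁ B. The set S is arbitrary: it may meet A, B and C.
  SupermodularConditioning : Set
  SupermodularConditioning = ∀ S A B C → A ⊆ B → C ⊆ ∁ B →
    marginal S A - marginal S (A ∪ C) ≥ marginal S B - marginal S (B ∪ C)

{-# OPTIONS --safe #-}

-- For y ∉ T, supermodularity of conditioning with ∅ ⊆ T and C = {y} gives
-- f(x ∣ T) - f(x ∣ T ∪ {y}) ≤ f(x ∣ ∅) - f(x ∣ y), and f(x ∣ ∅) = f(x) since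
-- f is normalized. Telescoping over the elements y of S yields the bound.

module Submission where

open import Defs
open import Data.Bool.Base using (true; false)
open import Data.Fin.Base using (Fin; zero; suc)
open import Data.Fin.Subset using (Subset; ⊥; ⁅_⁆; ∁; _∪_; _∈_; _∉_; _⊆_)
open import Data.Fin.Subset.Properties
  using (∪-identityˡ; ∪-identityʳ; ⊥⊆; x∉p⇒x∈∁p; x∈⁅y⁆⇒x≡y; drop-there)
open import Data.Nat.Base using (ℕ; _⊔_)
import Data.Nat.Properties as ℕ
open import Data.Product.Base using (_,_)
open import Data.Rational.Base as ℚ using (0ℚ; ½)
import Data.Rational.Properties as ℚ
open import Data.Rational.Solver using (module +-*-Solver)
open import Data.Sum.Base using (inj₁; inj₂)
open import Data.Vec.Base using ([]; _∷_)
open import Function.Base using (_∘_)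
open import Relation.Binary.PropositionalEquality using (_≡_; refl; sym; subst)
open +-*-Solver using (solve; con; _:=_; _:+_; _:-_; _:*_)

-- Carries every ring identity over from `ℚ`: a law that holds for each term of the sequences
-- becomes a link in a chain of `≤`. At its uses the endpoints are given explicitly, since `x ≤ y`
-- unfolds to a claim about `seq x` and `seq y`, from which the Cauchy proofs cannot be recovered.
≤-pointwise : ∀ {x y} → (∀ n → seq x n ≡ seq y n) → x ≤ y
≤-pointwise {x} {y} x≗y ε 0<ε = 0 , λ n _ → begin
  seq x n          ≡⟨ ℚ.+-identityʳ (seq x n) ⟨
  seq x n ℚ.+ 0ℚ   ≤⟨ ℚ.+-mono-≤ (ℚ.≤-reflexive (x≗y n)) (ℚ.<⇒≤ 0<ε) ⟩
  seq y n ℚ.+ ε    ∎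
  where open ℚ.≤-Reasoning

≤-refl : ∀ {x} → x ≤ x
≤-refl {x} = ≤-pointwise {x} {x} λ _ → refl

≤-trans : ∀ {x y z} → x ≤ y → y ≤ z → x ≤ z
≤-trans {x} {y} {z} x≤y y≤z ε 0<ε =
  let M , x≤y+ = x≤y (½ ℚ.* ε) 0<½ε
      N , y≤z+ = y≤z (½ ℚ.* ε) 0<½ε
  in M ⊔ N , λ n le → begin
    seq x n
      ≤⟨ x≤y+ n (ℕ.m⊔n≤o⇒m≤o M N le) ⟩
    seq y n ℚ.+ ½ ℚ.* ε
      ≤⟨ ℚ.+-monoˡ-≤ (½ ℚ.* ε) (y≤z+ n (ℕ.m⊔n≤o⇒n≤o M N le)) ⟩
    (seq z n ℚ.+ ½ ℚ.* ε) ℚ.+ ½ ℚ.* ε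
      ≡⟨ solve 2 (λ c e → (c :+ con ½ :* e) :+ con ½ :* e := c :+ e) refl (seq z n) ε ⟩
    seq z n ℚ.+ ε
      ∎
  where
  open ℚ.≤-Reasoning
  0<½ε : 0ℚ ℚ.< ½ ℚ.* ε
  0<½ε = subst (ℚ._< ½ ℚ.* ε) (ℚ.*-zeroʳ ½) (ℚ.*-monoʳ-<-pos ½ 0<ε)

-- Termwise `a = b + (a - b)` and `a - b ≤ ∣ a - b ∣`, so a distance of at most `ε` serves directly
-- as the slack `ε`.
≃⇒≤ : ∀ {x y} → x ≃ y → x ≤ y
≃⇒≤ {x} {y} x≃y ε 0<ε =
  let N , close = x≃y ε 0<ε
  in N , λ n N≤n → begin
    seq x n
      ≡⟨ solve 2 (λ a b → a := b :+ (a :- b)) refl (seq x n) (seq y n) ⟩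
    seq y n ℚ.+ (seq x n ℚ.- seq y n)
      ≤⟨ ℚ.+-monoʳ-≤ (seq y n) (ℚ.≤-trans (p≤∣p∣ (seq x n ℚ.- seq y n)) (close n N≤n)) ⟩
    seq y n ℚ.+ ε
      ∎
  where
  open ℚ.≤-Reasoning
  p≤∣p∣ : ∀ p → p ℚ.≤ ℚ.∣ p ∣
  p≤∣p∣ p with ℚ.≤-total 0ℚ p
  ... | inj₁ 0≤p = ℚ.≤-reflexive (sym (ℚ.0≤p⇒∣p∣≡p 0≤p))
  ... | inj₂ p≤0 = ℚ.≤-trans p≤0 (ℚ.0≤∣p∣ p)

+-monoˡ-≤ : ∀ {x y} z → x ≤ y → x + z ≤ y + z
+-monoˡ-≤ {x} {y} z x≤y ε 0<ε =
  let N , x≤y+ = x≤y ε 0<ε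
  in N , λ n N≤n → begin
    seq x n ℚ.+ seq z n
      ≤⟨ ℚ.+-monoˡ-≤ (seq z n) (x≤y+ n N≤n) ⟩
    (seq y n ℚ.+ ε) ℚ.+ seq z n
      ≡⟨ solve 3 (λ b e c → (b :+ e) :+ c := (b :+ c) :+ e) refl (seq y n) ε (seq z n) ⟩
    (seq y n ℚ.+ seq z n) ℚ.+ ε
      ∎
  where open ℚ.≤-Reasoning

x+y-y≤x : ∀ x y → (x + y) - y ≤ x
x+y-y≤x x y = ≤-pointwise {(x + y) - y} {x} λ k →
  solve 2 (λ a b → (a :+ b) :- b := a) refl (seq x k) (seq y k)

import Relation.Binary.Reasoning.Base.Single _≤_
  (λ {x} → ≤-refl {x}) (λ {x y z} → ≤-trans {x} {y} {z}) as ≤-Reasoning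

-- Induction on the ground set. Fixing the first bit to `false` turns `h` into a set function on the
-- remaining elements that inherits the step hypothesis; the first element, if present, is added
-- last.
∑-telescope : ∀ {n} (h : Subset n → ℝ) (g : Fin n → ℝ) →
  (∀ T y → y ∉ T → h T ≤ h (T ∪ ⁅ y ⁆) + g y) →
  ∀ S → h ⊥ ≤ h S + ∑ S g
∑-telescope h g step [] =
  ≤-pointwise {h []} {h [] + 0ℝ} λ k → sym (ℚ.+-identityʳ (seq (h []) k))
∑-telescope h g step (b ∷ S) = go b
  where
  open ≤-Reasoning
  tail : h ⊥ ≤ h (false ∷ S) + ∑ S (g ∘ suc)
  tail = ∑-telescope (h ∘ (false ∷_)) (g ∘ suc)
    (λ T y y∉T → step (false ∷ T) (suc y) (y∉T ∘ drop-there)) S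

  head : h (false ∷ S) ≤ h (true ∷ S) + g zero
  -- Adding `zero` computes to `true ∷ (S ∪ ⊥)`, so only the tail needs rewriting.
  head = subst (λ T → h (false ∷ S) ≤ h (true ∷ T) + g zero) (∪-identityʳ S)
    (step (false ∷ S) zero λ ())

  go : ∀ b → h ⊥ ≤ h (b ∷ S) + ∑ (b ∷ S) g
  go false = tail
  go true  = begin
    h ⊥                                           ∼⟨ tail ⟩
    h (false ∷ S) + ∑ S (g ∘ suc)                 ∼⟨ +-monoˡ-≤ {h (false ∷ S)} {h (true ∷ S) + g zero}
                                                       (∑ S (g ∘ suc)) head ⟩
    (h (true ∷ S) + g zero) + ∑ S (g ∘ suc)       ∼⟨ ≤-pointwise {(h (true ∷ S) + g zero) + ∑ S (g ∘ suc)}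
                                                       {h (true ∷ S) + (g zero + ∑ S (g ∘ suc))}
                                                       (λ k → ℚ.+-assoc (seq (h (true ∷ S)) k) (seq (g zero) k)
                                                         (seq (∑ S (g ∘ suc)) k)) ⟩
    h (true ∷ S) + (g zero + ∑ S (g ∘ suc))       ∎

∑-lower-bound : ∀ {n} (h : Subset n → ℝ) (g : Fin n → ℝ) →
  (∀ T y → y ∉ T → h T ≤ h (T ∪ ⁅ y ⁆) + g y) →
  ∀ x → x ≤ h ⊥ → ∀ S → h S ≥ x - ∑ S g
∑-lower-bound h g step x x≤h⊥ S = begin
  x - ∑ S g               ∼⟨ +-monoˡ-≤ {x} {h ⊥} (- ∑ S g) x≤h⊥ ⟩
  h ⊥ - ∑ S g             ∼⟨ +-monoˡ-≤ {h ⊥} {h S + ∑ S g} (- ∑ S g) (∑-telescope h g step S) ⟩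
  (h S + ∑ S g) - ∑ S g   ∼⟨ x+y-y≤x (h S) (∑ S g) ⟩
  h S                     ∎
  where open ≤-Reasoning

module _ {n : ℕ} (f : Subset n → ℝ) where

  open ≤-Reasoning

  -- Subtracting `f ⊥ ≥ 0` can only lower the value. This direction bounds the terms of the sum; the
  -- reverse one, from normalization, starts the telescope.
  marginal-⊥≤ : NonNegative f → ∀ T → marginal f T ⊥ ≤ f T
  marginal-⊥≤ f≥0 T rewrite ∪-identityˡ T = begin
    f T - f ⊥          ∼⟨ ≤-pointwise {f T - f ⊥} {0ℝ + (f T - f ⊥)} (λ k → sym (ℚ.+-identityˡ (seq (f T - f ⊥) k))) ⟩
    0ℝ + (f T - f ⊥)   ∼⟨ +-monoˡ-≤ {0ℝ} {f ⊥} (f T - f ⊥) (f≥0 ⊥) ⟩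
    f ⊥ + (f T - f ⊥)  ∼⟨ ≤-pointwise {f ⊥ + (f T - f ⊥)} {f T} (λ k →
                            solve 2 (λ a b → a :+ (b :- a) := b) refl (seq (f ⊥) k) (seq (f T) k)) ⟩
    f T                ∎

  ≤marginal-⊥ : Normalized f → ∀ T → f T ≤ marginal f T ⊥
  ≤marginal-⊥ f⊥≃0 T rewrite ∪-identityˡ T = begin
    f T                ∼⟨ ≤-pointwise {f T} {f ⊥ + (f T - f ⊥)} (λ k →
                            solve 2 (λ a b → b := a :+ (b :- a)) refl (seq (f ⊥) k) (seq (f T) k)) ⟩
    f ⊥ + (f T - f ⊥)  ∼⟨ +-monoˡ-≤ {f ⊥} {0ℝ} (f T - f ⊥) (≃⇒≤ {f ⊥} {0ℝ} f⊥≃0) ⟩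
    0ℝ + (f T - f ⊥)   ∼⟨ ≤-pointwise {0ℝ + (f T - f ⊥)} {f T - f ⊥} (λ k → ℚ.+-identityˡ (seq (f T - f ⊥) k)) ⟩
    f T - f ⊥          ∎

  -- The conditioning inequality, rearranged into the step hypothesis of the telescope for the set
  -- function `marginal f U`.
  marginal-step : NonNegative f → SupermodularConditioning f → ∀ U T y → y ∉ T →
    marginal f U T ≤ marginal f U (T ∪ ⁅ y ⁆) + (f U - marginal f U ⁅ y ⁆)
  marginal-step f≥0 sc U T y y∉T = begin
    h T                                       ∼⟨ ≤-pointwise {h T} {(h T - h T⁺) + h T⁺} (λ k →
                                                   solve 2 (λ a b → a := (a :- b) :+ b) refl (seq (h T) k) (seq (h T⁺) k)) ⟩
    (h T - h T⁺) + h T⁺                       ∼⟨ +-monoˡ-≤ {h T - h T⁺} {h ⊥ - h ⁅ y ⁆} (h T⁺) conditioned ⟩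
    (h ⊥ - h ⁅ y ⁆) + h T⁺                    ∼⟨ +-monoˡ-≤ {h ⊥ - h ⁅ y ⁆} {f U - h ⁅ y ⁆} (h T⁺)
                                                   (+-monoˡ-≤ {h ⊥} {f U} (- h ⁅ y ⁆) (marginal-⊥≤ f≥0 U)) ⟩
    (f U - h ⁅ y ⁆) + h T⁺                    ∼⟨ ≤-pointwise {(f U - h ⁅ y ⁆) + h T⁺} {h T⁺ + (f U - h ⁅ y ⁆)}
                                                   (λ k → ℚ.+-comm (seq (f U - h ⁅ y ⁆) k) (seq (h T⁺) k)) ⟩
    h T⁺ + (f U - h ⁅ y ⁆)                    ∎
    where
    h  = marginal f U
    T⁺ = T ∪ ⁅ y ⁆

    y⊆∁T : ⁅ y ⁆ ⊆ ∁ T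
    y⊆∁T z∈ = subst (_∈ ∁ T) (sym (x∈⁅y⁆⇒x≡y y z∈)) (x∉p⇒x∈∁p y∉T)

    conditioned : h T - h T⁺ ≤ h ⊥ - h ⁅ y ⁆
    -- The nested pair is `⊥ ⊆ T` and the added set is `⁅ y ⁆`, disjoint from `T` because `y ∉ T`;
    -- the `subst` turns `⊥ ∪ ⁅ y ⁆` into `⁅ y ⁆`.
    conditioned = subst (λ A → h T - h T⁺ ≤ h ⊥ - h A) (∪-identityˡ ⁅ y ⁆)
      (sc U ⊥ T ⁅ y ⁆ ⊥⊆ y⊆∁T)

theorem4 : ∀ (n : ℕ) (f : Subset n → ℝ) →
    NonNegative f → Normalized f → Monotone f → Submodular f →
    SupermodularConditioning f →
    ∀ (S : Subset n) (x : Fin n) → x ∉ S →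
    marginal f ⁅ x ⁆ S ≥ f ⁅ x ⁆ - ∑ S (λ y → f ⁅ x ⁆ - marginal f ⁅ x ⁆ ⁅ y ⁆)
theorem4 n f f≥0 f⊥≃0 _ _ sc S x _ =
  ∑-lower-bound (marginal f ⁅ x ⁆) (λ y → f ⁅ x ⁆ - marginal f ⁅ x ⁆ ⁅ y ⁆)
    (marginal-step f f≥0 sc ⁅ x ⁆) (f ⁅ x ⁆) (≤marginal-⊥ f f⊥≃0 ⁅ x ⁆) S
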